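{- An element $\boldsymbol\pi\in H_{1,2,2}$ is a prime of $H_{1,2,2}$ if and only if $N(\boldsymbol\pi)$ is a rational prime.
   Context: Let $\mathbf{i},\mathbf{j},\mathbf{k}$ be the standard quaternion units; $\overline{\mathbf{q}}$ is quaternion conjugation and $N(\mathbf{q})=\mathbf{q}\overline{\mathbf{q}}$. $H_{1,2,2}$ is the subring of the quaternions equal to the $\mathbb{Z}$-module generated by $\mathbf{v}_1=1$, $\mathbf{v}_2=\mathbf{i}$, $\mathbf{v}_3=\tfrac12(1+\mathbf{i}+\sqrt2\,\mathbf{j})$, $\mathbf{v}_4=\tfrac12(1+\mathbf{i}+\sqrt2\,\mathbf{k})$. A unit is an element invertible in $H_{1,2,2}$ (equivalently of norm 1). A prime of $H_{1,2,2}$ is a nonzero nonunit $\boldsymbol\pi$ such that whenever $\boldsymbol\pi=\mathbf{a}\mathbf{b}$ with $\mathbf{a},\mathbf{b}\in H_{1,2,2}$, at least one of $\mathbf{a},\mathbf{b}$ is a unit. -}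

module Defs where

open import Data.Integer.Base using (ℤ)
open import Data.Product.Base using (_×_; ∃-syntax)
open import Data.Rational.Base as ℚ using (ℚ; 0ℚ; 1ℚ; ½)
open import Data.Rational.Literals using (fromℤ)
open import Data.Sum.Base using (_⊎_)
open import Level using (0ℓ)
open import Relation.Binary.PropositionalEquality.Core using (_≡_; _≢_)
open import Relation.Nullary.Negation.Core using (¬_)
open import Relation.Unary using (Pred; _∈_)

-- The real quadratic field ℚ(√2): ⟨ a , b ⟩ stands for a + b√2.  Since √2 is
-- irrational, the representation is unique and _≡_ is equality of numbers.

record ℚ√2 : Set where
  constructor ⟨_,_⟩
  field
    rat irr : ℚ

module K where

  infixl 6 _+_ _-_
  infixl 7 _*_
  infix  8 -_

  fromℚ : ℚ → ℚ√2
  fromℚ r = ⟨ r , 0ℚ ⟩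

  0# √2 : ℚ√2
  0# = fromℚ 0ℚ
  √2 = ⟨ 0ℚ , 1ℚ ⟩

  _+_ _-_ _*_ : ℚ√2 → ℚ√2 → ℚ√2
  ⟨ a , b ⟩ + ⟨ c , d ⟩ = ⟨ a ℚ.+ c , b ℚ.+ d ⟩
  ⟨ a , b ⟩ - ⟨ c , d ⟩ = ⟨ a ℚ.- c , b ℚ.- d ⟩
  ⟨ a , b ⟩ * ⟨ c , d ⟩ =
    ⟨ a ℚ.* c ℚ.+ (b ℚ.* d ℚ.+ b ℚ.* d) , a ℚ.* d ℚ.+ b ℚ.* c ⟩

  -_ : ℚ√2 → ℚ√2
  - ⟨ a , b ⟩ = ⟨ ℚ.- a , ℚ.- b ⟩

-- Hamilton's quaternions re + im₁ i + im₂ j + im₃ k.  Coordinates are taken in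
-- ℚ(√2) ⊂ ℝ, which contains those of every element of H₁,₂,₂ and is closed
-- under all the operations involved.

record ℍ : Set where
  constructor quat
  field
    re im₁ im₂ im₃ : ℚ√2

infixl 6 _+_
infixl 7 _*_

fromK : ℚ√2 → ℍ
fromK x = quat x K.0# K.0# K.0#

fromRational : ℚ → ℍ
fromRational r = fromK (K.fromℚ r)

fromInteger : ℤ → ℍ
fromInteger n = fromRational (fromℤ n)

0ℍ 1ℍ i j k : ℍ
0ℍ = fromRational 0ℚ
1ℍ = fromRational 1ℚ
i  = quat K.0# (K.fromℚ 1ℚ) K.0# K.0#
j  = quat K.0# K.0# (K.fromℚ 1ℚ) K.0#
k  = quat K.0# K.0# K.0# (K.fromℚ 1ℚ)

_+_ _*_ : ℍ → ℍ → ℍ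
quat a b c d + quat a′ b′ c′ d′ =
  quat (a K.+ a′) (b K.+ b′) (c K.+ c′) (d K.+ d′)
quat a b c d * quat a′ b′ c′ d′ = quat
  (a K.* a′ K.- b K.* b′ K.- c K.* c′ K.- d K.* d′)
  (a K.* b′ K.+ b K.* a′ K.+ c K.* d′ K.- d K.* c′)
  (a K.* c′ K.- b K.* d′ K.+ c K.* a′ K.+ d K.* b′)
  (a K.* d′ K.+ b K.* c′ K.- c K.* b′ K.+ d K.* a′)

conj : ℍ → ℍ
conj (quat a b c d) = quat a (K.- b) (K.- c) (K.- d)

N : ℍ → ℍ
N q = q * conj q

v₁ v₂ v₃ v₄ : ℍ
v₁ = 1ℍ
v₂ = i
v₃ = fromRational ½ * (1ℍ + i + fromK K.√2 * j)
v₄ = fromRational ½ * (1ℍ + i + fromK K.√2 * k)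

H₁,₂,₂ : Pred ℍ 0ℓ
H₁,₂,₂ q = ∃[ a ] ∃[ b ] ∃[ c ] ∃[ d ]
  q ≡ fromInteger a * v₁ + fromInteger b * v₂ + fromInteger c * v₃ + fromInteger d * v₄

IsUnit : Pred ℍ 0ℓ
IsUnit u = u ∈ H₁,₂,₂ × ∃[ w ] (w ∈ H₁,₂,₂ × u * w ≡ 1ℍ × w * u ≡ 1ℍ)

record IsPrime (π : ℍ) : Set where
  field
    integral : π ∈ H₁,₂,₂
    nonzero  : π ≢ 0ℍ
    nonunit  : ¬ IsUnit π
    factor   : ∀ a b → a ∈ H₁,₂,₂ → b ∈ H₁,₂,₂ → π ≡ a * b → IsUnit a ⊎ IsUnit b

{-# OPTIONS --safe #-}
-- In the coordinates of v₁, …, v₄ the norm is a positive definite integral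
-- quadratic form, and rounding shows that H₁,₂,₂ is norm-Euclidean on the
-- right, so any two elements have a right gcd δ = x α + y β.
--
-- Let z be irreducible and let p be a rational prime dividing N z.  The gcd δ of
-- z = a δ and p = b δ is not a unit, because N δ ≡ N (x z) ≡ 0 mod p; so a is a
-- unit and p² = N b · N z, whence N z = p unless b is a unit, i.e. z = u p with a
-- unit u.  The latter is impossible: p divides 1 + x² + y² = N t for some t
-- which is not a multiple of p, and the gcd of t and p properly divides p.
module Submission where

open import Defs
open import Data.Fin.Base as Fin using (Fin; combine; fromℕ<; join; splitAt; toℕ)
open import Data.Fin.Patterns
import Data.Fin.Properties as Fin
open import Data.Integer.Base as ℤ using (ℤ; +_; ∣_∣; 0ℤ; 1ℤ)
open import Data.Integer.Divisibility.Signed as ℤ using (divides; ∣⇒∣ᵤ; ∣ᵤ⇒∣)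
open import Data.Integer.DivMod using (_%ℕ_; _/ℕ_; n%ℕd<d; a≡a%ℕn+[a/ℕn]*n)
import Data.Integer.Properties as ℤ
open import Data.Integer.Solver renaming (module +-*-Solver to ℤ-Solver)
open import Data.List.Base using ([]; _∷_)
open import Data.List.Relation.Unary.All using (_∷_)
open import Data.Nat.Base as ℕ using (ℕ; suc; NonZero; _≤_; _<_)
open import Data.Nat.Divisibility as ℕ using (_∣_)
open import Data.Nat.DivMod using (m≡m%n+[m/n]*n; m%n<n)
open import Data.Nat.Induction using (<-wellFounded; Acc; acc)
open import Data.Nat.ListAction using (product)
open import Data.Nat.Primality
  using (Prime; ¬prime[0]; ¬prime[1]; euclidsLemma; prime⇒irreducible; prime⇒nonZero)
open import Data.Nat.Primality.Factorisation using (factorise)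
import Data.Nat.Properties as ℕ
open import Data.Nat.Solver renaming (module +-*-Solver to ℕ-Solver)
open import Data.Product.Base using (_×_; _,_; proj₁; proj₂; ∃-syntax)
open import Data.Rational.Base as ℚ using (ℚ; 0ℚ; 1ℚ; ½)
open import Data.Rational.Literals using (fromℤ)
import Data.Rational.Properties as ℚ
open import Data.Rational.Solver renaming (module +-*-Solver to ℚ-Solver)
open import Data.Rational.Unnormalised.Base using (*≡*)
import Data.Rational.Unnormalised.Properties as ℚᵘ
open import Data.Sum.Base using (_⊎_; inj₁; inj₂; [_,_]′)
open import Data.Vec.Base using (Vec; []; _∷_; concat; map; tabulate)
open import Function.Base using (_∘_)
open import Function.Bundles using (_⇔_; mk⇔)
open import Relation.Binary.Definitions using (tri<; tri≈; tri>)
open import Relation.Binary.PropositionalEquality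
open import Relation.Nullary using (¬_; yes; no; contradiction)
open import Relation.Unary using (_∈_)

-- Coordinate vectors and the formulas of the ring

-- coords a b c d stands for a v₁ + b v₂ + c v₃ + d v₄.
record Coords (A : Set) : Set where
  constructor coords
  field
    c₁ c₂ c₃ c₄ : A

open Coords

coords-cong : ∀ {A : Set} {a a′ b b′ c c′ d d′ : A} →
  a ≡ a′ → b ≡ b′ → c ≡ c′ → d ≡ d′ → coords a b c d ≡ coords a′ b′ c′ d′
coords-cong refl refl refl refl = refl

mapCoords : ∀ {A B : Set} → (A → B) → Coords A → Coords B
mapCoords f (coords a b c d) = coords (f a) (f b) (f c) (f d)

-- The formulas are overloaded so that they can also be instantiated at the
-- polynomials of the ring solvers.
record Ops (A : Set) : Set where
  infixl 6 _⊕_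
  infixl 7 _⊗_
  infix  8 ⊝_
  field
    _⊕_ _⊗_ : A → A → A
    ⊝_      : A → A
    0#      : A

open Ops {{...}}

infixl 6 _⊖_ _+ᶜ_ _-ᶜ_
infixl 7 _·_ _•_ _∗_

private
  variable
    A : Set

_⊖_ : {{Ops A}} → A → A → A
x ⊖ y = x ⊕ (⊝ y)

-- The product comes from v₃² = v₃ − 1, v₄² = v₄ − 1, i v₃ = v₄ − 1, i v₄ = i − v₃,
-- v₃ i = i − v₄, v₄ i = v₃ − 1, v₃ v₄ = i and v₄ v₃ = v₃ + v₄ − 1 − i.
_+ᶜ_ _-ᶜ_ _·_ : {{Ops A}} → Coords A → Coords A → Coords A
coords a b c d +ᶜ coords a′ b′ c′ d′ =
  coords (a ⊕ a′) (b ⊕ b′) (c ⊕ c′) (d ⊕ d′)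
coords a b c d -ᶜ coords a′ b′ c′ d′ =
  coords (a ⊖ a′) (b ⊖ b′) (c ⊖ c′) (d ⊖ d′)
coords a b c d · coords a′ b′ c′ d′ = coords
  (a ⊗ a′ ⊖ b ⊗ b′ ⊖ b ⊗ c′ ⊖ c ⊗ c′ ⊖ d ⊗ d′ ⊖ d ⊗ b′ ⊖ d ⊗ c′)
  (a ⊗ b′ ⊕ b ⊗ a′ ⊕ b ⊗ d′ ⊕ c ⊗ b′ ⊕ c ⊗ d′ ⊖ d ⊗ c′)
  (a ⊗ c′ ⊕ c ⊗ a′ ⊖ b ⊗ d′ ⊕ c ⊗ c′ ⊕ d ⊗ b′ ⊕ d ⊗ c′)
  (a ⊗ d′ ⊕ d ⊗ a′ ⊕ b ⊗ c′ ⊖ c ⊗ b′ ⊕ d ⊗ d′ ⊕ d ⊗ c′)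

_•_ : {{Ops A}} → A → Coords A → Coords A
n • coords a b c d = coords (n ⊗ a) (n ⊗ b) (n ⊗ c) (n ⊗ d)

scalar : {{Ops A}} → A → Coords A
scalar n = coords n 0# 0# 0#

-- Both v₃ and v₄ have real part ½, so their conjugates are 1 - v₃ and 1 - v₄.
conjᶜ : {{Ops A}} → Coords A → Coords A
conjᶜ (coords a b c d) = coords (a ⊕ c ⊕ d) (⊝ b) (⊝ c) (⊝ d)

-- Completing squares gives X² + Y² + (c² + d²)/2 with X = a + (c + d)/2 and Y = b + (c + d)/2.
norm : {{Ops A}} → Coords A → A
norm (coords a b c d) =
  a ⊗ a ⊕ b ⊗ b ⊕ (a ⊕ b) ⊗ (c ⊕ d) ⊕ c ⊗ c ⊕ c ⊗ d ⊕ d ⊗ d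

-- The symmetric bilinear form `norm (x +ᶜ y)` - `norm x` - `norm y`.
polar : {{Ops A}} → Coords A → Coords A → A
polar (coords a b c d) (coords a′ b′ c′ d′) =
  a ⊗ a′ ⊕ a ⊗ a′ ⊕ b ⊗ b′ ⊕ b ⊗ b′
    ⊕ (a ⊕ b) ⊗ (c′ ⊕ d′) ⊕ (a′ ⊕ b′) ⊗ (c ⊕ d)
    ⊕ c ⊗ c′ ⊕ c ⊗ c′ ⊕ c ⊗ d′ ⊕ c′ ⊗ d ⊕ d ⊗ d′ ⊕ d ⊗ d′

-- Multiplication in the basis 1, i, √2 j, √2 k.
_∗_ : {{Ops A}} → Coords A → Coords A → Coords A
coords a b c d ∗ coords a′ b′ c′ d′ = coords
  (a ⊗ a′ ⊖ b ⊗ b′ ⊖ (c ⊗ c′ ⊕ c ⊗ c′) ⊖ (d ⊗ d′ ⊕ d ⊗ d′))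
  (a ⊗ b′ ⊕ b ⊗ a′ ⊕ (c ⊗ d′ ⊕ c ⊗ d′) ⊖ (d ⊗ c′ ⊕ d ⊗ c′))
  (a ⊗ c′ ⊖ b ⊗ d′ ⊕ c ⊗ a′ ⊕ d ⊗ b′)
  (a ⊗ d′ ⊕ b ⊗ c′ ⊖ c ⊗ b′ ⊕ d ⊗ a′)

-- Change of basis from v₁, ..., v₄ to 1, i, √2 j, √2 k. The constant ½ is an argument so that it
-- can also be a constant polynomial.
toAxes : {{Ops A}} → A → Coords A → Coords A
toAxes half (coords a b c d) = coords
  (a ⊕ c ⊗ half ⊕ d ⊗ half) (b ⊕ c ⊗ half ⊕ d ⊗ half) (c ⊗ half) (d ⊗ half)

conjAxes : {{Ops A}} → Coords A → Coords A
conjAxes (coords a b c d) = coords a (⊝ b) (⊝ c) (⊝ d)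

instance
  ℤ-ops : Ops ℤ
  ℤ-ops = record { _⊕_ = ℤ._+_; _⊗_ = ℤ._*_; ⊝_ = ℤ.-_; 0# = 0ℤ }

  ℚ-ops : Ops ℚ
  ℚ-ops = record { _⊕_ = ℚ._+_; _⊗_ = ℚ._*_; ⊝_ = ℚ.-_; 0# = 0ℚ }

  ℤ-poly-ops : ∀ {n} → Ops (ℤ-Solver.Polynomial n)
  ℤ-poly-ops = record
    { _⊕_ = ℤ-Solver._:+_; _⊗_ = ℤ-Solver._:*_; ⊝_ = ℤ-Solver.:-_; 0# = ℤ-Solver.con 0ℤ }

  ℚ-poly-ops : ∀ {n} → Ops (ℚ-Solver.Polynomial n)
  ℚ-poly-ops = record
    { _⊕_ = ℚ-Solver._:+_; _⊗_ = ℚ-Solver._:*_; ⊝_ = ℚ-Solver.:-_; 0# = ℚ-Solver.con 0ℚ }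

-- Ring-solver proofs of identities between coordinate vectors

module CoordSolver
  {A : Set} (Poly : ℕ → Set) (var : ∀ {n} → Fin n → Poly n)
  (⟦_⟧ ⟦_⟧↓ : ∀ {n} → Poly n → Vec A n → A)
  (prove : ∀ {n} (ρ : Vec A n) p q → ⟦ p ⟧↓ ρ ≡ ⟦ q ⟧↓ ρ → ⟦ p ⟧ ρ ≡ ⟦ q ⟧ ρ)
  where

  flatten : ∀ {n} → Vec (Coords A) n → Vec A (n ℕ.* 4)
  flatten = concat ∘ map λ x → c₁ x ∷ c₂ x ∷ c₃ x ∷ c₄ x ∷ []

  varᶜ : ∀ {n} → Fin n → Coords (Poly (n ℕ.* 4))
  varᶜ i = coords (v 0F) (v 1F) (v 2F) (v 3F)
    where v = λ j → var (combine i j)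

  -- The unknowns are coordinate vectors too; a scalar unknown is passed as the
  -- first coordinate of one.
  solveᶜ : ∀ {n} (ρ : Vec (Coords A) n)
    (e : Vec (Coords (Poly (n ℕ.* 4))) n → Coords (Poly (n ℕ.* 4)) × Coords (Poly (n ℕ.* 4))) →
    let x , y = e (tabulate varᶜ) in
    mapCoords (λ p → ⟦ p ⟧↓ (flatten ρ)) x ≡ mapCoords (λ p → ⟦ p ⟧↓ (flatten ρ)) y →
    mapCoords (λ p → ⟦ p ⟧ (flatten ρ)) x ≡ mapCoords (λ p → ⟦ p ⟧ (flatten ρ)) y
  solveᶜ ρ e eq = coords-cong
    (prove (flatten ρ) (c₁ x) (c₁ y) (cong c₁ eq))
    (prove (flatten ρ) (c₂ x) (c₂ y) (cong c₂ eq))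
    (prove (flatten ρ) (c₃ x) (c₃ y) (cong c₃ eq))
    (prove (flatten ρ) (c₄ x) (c₄ y) (cong c₄ eq))
    where
    x = proj₁ (e (tabulate varᶜ))
    y = proj₂ (e (tabulate varᶜ))

module ℤᶜ = CoordSolver ℤ-Solver.Polynomial ℤ-Solver.var ℤ-Solver.⟦_⟧ ℤ-Solver.⟦_⟧↓ ℤ-Solver.prove
module ℚᶜ = CoordSolver ℚ-Solver.Polynomial ℚ-Solver.var ℚ-Solver.⟦_⟧ ℚ-Solver.⟦_⟧↓ ℚ-Solver.prove

-- From integer coordinates to quaternions

fromℤ-+ : ∀ x y → fromℤ (x ℤ.+ y) ≡ fromℤ x ℚ.+ fromℤ y
fromℤ-+ x y = ℚ.toℚᵘ-injective (ℚᵘ.≃-trans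
  (*≡* (solve 2 (λ x y → (x :+ y) :* con 1ℤ := (x :* con 1ℤ :+ y :* con 1ℤ) :* con 1ℤ) refl x y))
  (ℚᵘ.≃-sym (ℚ.toℚᵘ-homo-+ (fromℤ x) (fromℤ y))))
  where open ℤ-Solver

fromℤ-* : ∀ x y → fromℤ (x ℤ.* y) ≡ fromℤ x ℚ.* fromℤ y
fromℤ-* x y = ℚ.toℚᵘ-injective (ℚᵘ.≃-sym (ℚ.toℚᵘ-homo-* (fromℤ x) (fromℤ y)))

fromℤ-neg : ∀ x → fromℤ (ℤ.- x) ≡ ℚ.- fromℤ x
fromℤ-neg (+ 0) = refl
fromℤ-neg ℤ.+[1+ _ ] = refl
fromℤ-neg ℤ.-[1+ _ ] = refl

fromℤ-· : ∀ x y → mapCoords fromℤ (x · y) ≡ mapCoords fromℤ x · mapCoords fromℤ y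
fromℤ-· (coords a b c d) (coords a′ b′ c′ d′) = coords-cong
  ((((((a ⟨*⟩ a′ ⟨-⟩ b ⟨*⟩ b′) ⟨-⟩ b ⟨*⟩ c′) ⟨-⟩ c ⟨*⟩ c′) ⟨-⟩ d ⟨*⟩ d′) ⟨-⟩ d ⟨*⟩ b′) ⟨-⟩ d ⟨*⟩ c′)
  (((((a ⟨*⟩ b′ ⟨+⟩ b ⟨*⟩ a′) ⟨+⟩ b ⟨*⟩ d′) ⟨+⟩ c ⟨*⟩ b′) ⟨+⟩ c ⟨*⟩ d′) ⟨-⟩ d ⟨*⟩ c′)
  (((((a ⟨*⟩ c′ ⟨+⟩ c ⟨*⟩ a′) ⟨-⟩ b ⟨*⟩ d′) ⟨+⟩ c ⟨*⟩ c′) ⟨+⟩ d ⟨*⟩ b′) ⟨+⟩ d ⟨*⟩ c′)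
  (((((a ⟨*⟩ d′ ⟨+⟩ d ⟨*⟩ a′) ⟨+⟩ b ⟨*⟩ c′) ⟨-⟩ c ⟨*⟩ b′) ⟨+⟩ d ⟨*⟩ d′) ⟨+⟩ d ⟨*⟩ c′)
  where
  infixl 6 _⟨+⟩_ _⟨-⟩_
  infixl 7 _⟨*⟩_
  _⟨*⟩_ = fromℤ-*
  _⟨+⟩_ : ∀ {x y x′ y′} → fromℤ x ≡ x′ → fromℤ y ≡ y′ → fromℤ (x ℤ.+ y) ≡ x′ ℚ.+ y′
  _⟨+⟩_ {x} {y} p q = trans (fromℤ-+ x y) (cong₂ ℚ._+_ p q)
  _⟨-⟩_ : ∀ {x y x′ y′} → fromℤ x ≡ x′ → fromℤ y ≡ y′ → fromℤ (x ℤ.- y) ≡ x′ ℚ.- y′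
  _⟨-⟩_ {x} {y} p q = p ⟨+⟩ trans (fromℤ-neg y) (cong ℚ.-_ q)

-- a + b i + c √2 j + d √2 k
axes : Coords ℚ → ℍ
axes (coords a b c d) = quat ⟨ a , 0ℚ ⟩ ⟨ b , 0ℚ ⟩ ⟨ 0ℚ , c ⟩ ⟨ 0ℚ , d ⟩

quat-cong : ∀ {a a′ b b′ c c′ d d′} →
  a ≡ a′ → b ≡ b′ → c ≡ c′ → d ≡ d′ → quat a b c d ≡ quat a′ b′ c′ d′
quat-cong refl refl refl refl = refl

-- The coordinates of `axes` are rational along 1, i and rational multiples of √2 along j, k, so
-- four kinds of products occur. Two multiples of √2 have a rational product, whence the doubled
-- terms of `_∗_`.
axes-* : ∀ x y → axes x * axes y ≡ axes (x ∗ y)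
axes-* (coords a b c d) (coords a′ b′ c′ d′) = quat-cong
  (rr a a′ ⟨-⟩ rr b b′ ⟨-⟩ ii c c′ ⟨-⟩ ii d d′)
  (rr a b′ ⟨+⟩ rr b a′ ⟨+⟩ ii c d′ ⟨-⟩ ii d c′)
  (ri a c′ ⟨-⟩ ri b d′ ⟨+⟩ ir c a′ ⟨+⟩ ir d b′)
  (ri a d′ ⟨+⟩ ri b c′ ⟨-⟩ ir c b′ ⟨+⟩ ir d a′)
  where
  open ℚ-Solver
  infixl 6 _⟨+⟩_ _⟨-⟩_
  _⟨+⟩_ = cong₂ K._+_
  _⟨-⟩_ = cong₂ K._-_
  K-cong = cong₂ ⟨_,_⟩
  o = con 0ℚ
  rr : ∀ x y → ⟨ x , 0ℚ ⟩ K.* ⟨ y , 0ℚ ⟩ ≡ ⟨ x ℚ.* y , 0ℚ ⟩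
  rr x y = K-cong (solve 2 (λ x y → x :* y :+ (o :* o :+ o :* o) := x :* y) refl x y)
    (solve 2 (λ x y → x :* o :+ o :* y := o) refl x y)
  ii : ∀ x y → ⟨ 0ℚ , x ⟩ K.* ⟨ 0ℚ , y ⟩ ≡ ⟨ x ℚ.* y ℚ.+ x ℚ.* y , 0ℚ ⟩
  ii x y = K-cong (solve 2 (λ x y → o :* o :+ (x :* y :+ x :* y) := x :* y :+ x :* y) refl x y)
    (solve 2 (λ x y → o :* y :+ x :* o := o) refl x y)
  ri : ∀ x y → ⟨ x , 0ℚ ⟩ K.* ⟨ 0ℚ , y ⟩ ≡ ⟨ 0ℚ , x ℚ.* y ⟩
  ri x y = K-cong (solve 2 (λ x y → x :* o :+ (o :* y :+ o :* y) := o) refl x y)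
    (solve 2 (λ x y → x :* y :+ o :* o := x :* y) refl x y)
  ir : ∀ x y → ⟨ 0ℚ , x ⟩ K.* ⟨ y , 0ℚ ⟩ ≡ ⟨ 0ℚ , x ℚ.* y ⟩
  ir x y = K-cong (solve 2 (λ x y → o :* y :+ (x :* o :+ x :* o) := o) refl x y)
    (solve 2 (λ x y → o :* o :+ x :* y := x :* y) refl x y)

-- Written exactly as the sum in `H₁,₂,₂`, so that `refl` witnesses membership.
⟦_⟧ : Coords ℤ → ℍ
⟦ coords a b c d ⟧ =
  fromInteger a * v₁ + fromInteger b * v₂ + fromInteger c * v₃ + fromInteger d * v₄

∗-scalar : ∀ r x → scalar r ∗ x ≡ r • x
∗-scalar r x = ℚᶜ.solveᶜ (scalar r ∷ x ∷ [])
  (λ { (ρ ∷ χ ∷ []) → scalar (c₁ ρ) ∗ χ , c₁ ρ • χ }) refl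

toAxes-· : ∀ x y → toAxes ½ x ∗ toAxes ½ y ≡ toAxes ½ (x · y)
toAxes-· x y = ℚᶜ.solveᶜ (x ∷ y ∷ [])
  (λ { (χ ∷ υ ∷ []) → let h = ℚ-Solver.con ½ in
    toAxes h χ ∗ toAxes h υ , toAxes h (χ · υ) }) refl

⟦⟧≡axes : ∀ x → ⟦ x ⟧ ≡ axes (toAxes ½ (mapCoords fromℤ x))
⟦⟧≡axes x@(coords a b c d) = begin
  ⟦ x ⟧
    -- Each basis element v₁, ..., v₄ computes to `axes` of the corresponding e₁, ..., e₄, and a sum
    -- of values of `axes` computes to `axes` of the sum.
    ≡⟨ cong₂ _+_ (cong₂ _+_ (cong₂ _+_ (scale a e₁) (scale b e₂)) (scale c e₃)) (scale d e₄) ⟩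
  axes (fromℤ a • e₁ +ᶜ fromℤ b • e₂ +ᶜ fromℤ c • e₃ +ᶜ fromℤ d • e₄)
    ≡⟨ cong axes (ℚᶜ.solveᶜ (mapCoords fromℤ x ∷ []) (λ { (χ ∷ []) →
         let 𝟘 = con 0ℚ; 𝟙 = con 1ℚ; h = con ½ in
         c₁ χ • coords 𝟙 𝟘 𝟘 𝟘 +ᶜ c₂ χ • coords 𝟘 𝟙 𝟘 𝟘
           +ᶜ c₃ χ • coords h h h 𝟘 +ᶜ c₄ χ • coords h h 𝟘 h , toAxes h χ }) refl) ⟩
  axes (toAxes ½ (mapCoords fromℤ x)) ∎
  where
  open ≡-Reasoning
  open ℚ-Solver using (con)
  e₁ e₂ e₃ e₄ : Coords ℚ
  e₁ = coords 1ℚ 0ℚ 0ℚ 0ℚ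
  e₂ = coords 0ℚ 1ℚ 0ℚ 0ℚ
  e₃ = coords ½ ½ ½ 0ℚ
  e₄ = coords ½ ½ 0ℚ ½
  scale : ∀ n y → fromInteger n * axes y ≡ axes (fromℤ n • y)
  scale n y = trans (axes-* (scalar (fromℤ n)) y) (cong axes (∗-scalar (fromℤ n) y))

-- Together with `conj-⟦⟧` and `⟦⟧-scalar` this moves the whole argument to integer coordinates. The
-- check takes place on the axes, where everything is rational.
⟦⟧-* : ∀ x y → ⟦ x ⟧ * ⟦ y ⟧ ≡ ⟦ x · y ⟧
⟦⟧-* x y = begin
  ⟦ x ⟧ * ⟦ y ⟧                             ≡⟨ cong₂ _*_ (⟦⟧≡axes x) (⟦⟧≡axes y) ⟩
  axes (toAxes ½ x′) * axes (toAxes ½ y′)   ≡⟨ axes-* (toAxes ½ x′) (toAxes ½ y′) ⟩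
  axes (toAxes ½ x′ ∗ toAxes ½ y′)          ≡⟨ cong axes (toAxes-· x′ y′) ⟩
  axes (toAxes ½ (x′ · y′))                 ≡⟨ cong (axes ∘ toAxes ½) (fromℤ-· x y) ⟨
  axes (toAxes ½ (mapCoords fromℤ (x · y))) ≡⟨ ⟦⟧≡axes (x · y) ⟨
  ⟦ x · y ⟧ ∎
  where
  open ≡-Reasoning
  x′ = mapCoords fromℤ x
  y′ = mapCoords fromℤ y

⟦⟧-scalar : ∀ n → ⟦ scalar n ⟧ ≡ fromInteger n
⟦⟧-scalar n = trans (⟦⟧≡axes (scalar n))
  (cong (λ r → axes (coords r 0ℚ 0ℚ 0ℚ)) (trans (ℚ.+-identityʳ _) (ℚ.+-identityʳ _)))

conj-⟦⟧ : ∀ x → conj ⟦ x ⟧ ≡ ⟦ conjᶜ x ⟧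
conj-⟦⟧ x = begin
  conj ⟦ x ⟧ ≡⟨ cong conj (⟦⟧≡axes x) ⟩
  conj (axes (toAxes ½ x′)) ≡⟨⟩
  axes (conjAxes (toAxes ½ x′))
    ≡⟨ cong axes (ℚᶜ.solveᶜ (x′ ∷ []) (λ { (χ ∷ []) → let h = ℚ-Solver.con ½ in
         conjAxes (toAxes h χ) , toAxes h (conjᶜ χ) }) refl) ⟩
  axes (toAxes ½ (conjᶜ x′)) ≡⟨ cong (axes ∘ toAxes ½) fromℤ-conj ⟨
  axes (toAxes ½ (mapCoords fromℤ (conjᶜ x))) ≡⟨ ⟦⟧≡axes (conjᶜ x) ⟨
  ⟦ conjᶜ x ⟧ ∎
  where
  open ≡-Reasoning
  x′ = mapCoords fromℤ x
  fromℤ-conj : mapCoords fromℤ (conjᶜ x) ≡ conjᶜ x′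
  fromℤ-conj = coords-cong
    (trans (fromℤ-+ (c₁ x ℤ.+ c₃ x) (c₄ x)) (cong (ℚ._+ fromℤ (c₄ x)) (fromℤ-+ (c₁ x) (c₃ x))))
    (fromℤ-neg (c₂ x)) (fromℤ-neg (c₃ x)) (fromℤ-neg (c₄ x))

-- Identities of the norm and the product

·-conj : ∀ x → x · conjᶜ x ≡ scalar (norm x)
·-conj x = ℤᶜ.solveᶜ (x ∷ []) (λ { (χ ∷ []) → χ · conjᶜ χ , scalar (norm χ) }) refl

N-⟦⟧ : ∀ x → N ⟦ x ⟧ ≡ fromInteger (norm x)
N-⟦⟧ x = begin
  ⟦ x ⟧ * conj ⟦ x ⟧  ≡⟨ cong (⟦ x ⟧ *_) (conj-⟦⟧ x) ⟩
  ⟦ x ⟧ * ⟦ conjᶜ x ⟧ ≡⟨ ⟦⟧-* x (conjᶜ x) ⟩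
  ⟦ x · conjᶜ x ⟧     ≡⟨ cong ⟦_⟧ (·-conj x) ⟩
  ⟦ scalar (norm x) ⟧ ≡⟨ ⟦⟧-scalar (norm x) ⟩
  fromInteger (norm x) ∎
  where open ≡-Reasoning

fromInteger-injective : ∀ {m n} → fromInteger m ≡ fromInteger n → m ≡ n
fromInteger-injective = cong (ℚ.numerator ∘ ℚ√2.rat ∘ ℍ.re)

⟦⟧-norm : ∀ {x y} → ⟦ x ⟧ ≡ ⟦ y ⟧ → norm x ≡ norm y
⟦⟧-norm {x} {y} eq = fromInteger-injective
  (trans (sym (N-⟦⟧ x)) (trans (cong N eq) (N-⟦⟧ y)))

norm-· : ∀ (x y : Coords ℤ) → norm (x · y) ≡ norm x ℤ.* norm y
-- `solveᶜ` compares coordinate vectors, so the two integers are packed into `scalar`.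
norm-· x y = cong c₁ (ℤᶜ.solveᶜ (x ∷ y ∷ [])
  (λ { (χ ∷ υ ∷ []) → scalar (norm (χ · υ)) , scalar (norm χ ⊗ norm υ) }) refl)

norm-conj : ∀ (x : Coords ℤ) → norm (conjᶜ x) ≡ norm x
norm-conj x = cong c₁ (ℤᶜ.solveᶜ (x ∷ [])
  (λ { (χ ∷ []) → scalar (norm (conjᶜ χ)) , scalar (norm χ) }) refl)

-- Shows that adding n • y leaves the norm unchanged mod n.
norm-+• : ∀ (x : Coords ℤ) n y →
  norm (x +ᶜ n • y) ≡ norm x ℤ.+ n ℤ.* (polar x y ℤ.+ n ℤ.* norm y)
norm-+• x n y = cong c₁ (ℤᶜ.solveᶜ (x ∷ scalar n ∷ y ∷ [])
  (λ { (χ ∷ ν ∷ υ ∷ []) → let n = c₁ ν in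
    scalar (norm (χ +ᶜ n • υ)) , scalar (norm χ ⊕ n ⊗ (polar χ υ ⊕ n ⊗ norm υ)) }) refl)

·-assoc : ∀ (x y z : Coords ℤ) → (x · y) · z ≡ x · (y · z)
·-assoc x y z = ℤᶜ.solveᶜ (x ∷ y ∷ z ∷ [])
  (λ { (χ ∷ υ ∷ ζ ∷ []) → (χ · υ) · ζ , χ · (υ · ζ) }) refl

conj-· : ∀ (x : Coords ℤ) → conjᶜ x · x ≡ scalar (norm x)
conj-· x = ℤᶜ.solveᶜ (x ∷ []) (λ { (χ ∷ []) → conjᶜ χ · χ , scalar (norm χ) }) refl

·-scalar : ∀ (x : Coords ℤ) n → x · scalar n ≡ n • x
·-scalar x n = ℤᶜ.solveᶜ (x ∷ scalar n ∷ [])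
  (λ { (χ ∷ ν ∷ []) → χ · scalar (c₁ ν) , c₁ ν • χ }) refl

scalar-· : ∀ n (x : Coords ℤ) → scalar n · x ≡ n • x
scalar-· n x = ℤᶜ.solveᶜ (x ∷ scalar n ∷ [])
  (λ { (χ ∷ ν ∷ []) → scalar (c₁ ν) · χ , c₁ ν • χ }) refl

1•x≡x : ∀ (x : Coords ℤ) → 1ℤ • x ≡ x
1•x≡x x = coords-cong (ℤ.*-identityˡ _) (ℤ.*-identityˡ _) (ℤ.*-identityˡ _) (ℤ.*-identityˡ _)

-- A natural number, for Euclidean descent and for divisibility by primes. By `norm≡+‖‖` the
-- absolute value loses nothing.
‖_‖ : Coords ℤ → ℕ
‖ x ‖ = ∣ norm x ∣

‖‖-· : ∀ x y → ‖ x · y ‖ ≡ ‖ x ‖ ℕ.* ‖ y ‖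
‖‖-· x y = trans (cong ∣_∣ (norm-· x y)) (ℤ.abs-* (norm x) (norm y))

‖‖-conj : ∀ x → ‖ conjᶜ x ‖ ≡ ‖ x ‖
‖‖-conj x = cong ∣_∣ (norm-conj x)

‖‖-scalar : ∀ n → ‖ scalar (+ n) ‖ ≡ n ℕ.* n
‖‖-scalar n = trans (cong ∣_∣ (solve 1 (λ n → norm (scalar n) := n :* n) refl (+ n)))
  (ℤ.abs-* (+ n) (+ n))
  where open ℤ-Solver

-- Positive definiteness of the norm

square : ℤ → ℕ
square i = ∣ i ∣ ℕ.* ∣ i ∣

i*i≡+square : ∀ i → i ℤ.* i ≡ + square i
i*i≡+square (+ n) = sym (ℤ.pos-* n n)
i*i≡+square ℤ.-[1+ _ ] = refl

-- Twice the coordinates along 1 and i, which may be half-integers.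
re₂ im₂ : Coords ℤ → ℤ
re₂ (coords a b c d) = a ℤ.+ a ℤ.+ (c ℤ.+ d)
im₂ (coords a b c d) = b ℤ.+ b ℤ.+ (c ℤ.+ d)

-- The factor 8 clears denominators and leaves squares of doubled coordinates only, all of which
-- `centredRemainder` can bound in the same way.
eightfold : Coords ℤ → ℕ
eightfold x = 2 ℕ.* square (re₂ x) ℕ.+ 2 ℕ.* square (im₂ x)
  ℕ.+ (square (c₃ x ℤ.+ c₃ x) ℕ.+ square (c₄ x ℤ.+ c₄ x))

8*norm : ∀ x → + 8 ℤ.* norm x ≡ + eightfold x
8*norm x@(coords a b c d) = begin
  + 8 ℤ.* norm x
    ≡⟨ solve 4 (λ a b c d →
         let X = a :+ a :+ (c :+ d); Y = b :+ b :+ (c :+ d); C = c :+ c; D = d :+ d in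
         con (+ 8) :* norm (coords a b c d) :=
         con (+ 2) :* (X :* X) :+ con (+ 2) :* (Y :* Y) :+ (C :* C :+ D :* D)) refl a b c d ⟩
  + 2 ℤ.* (re₂ x ℤ.* re₂ x) ℤ.+ + 2 ℤ.* (im₂ x ℤ.* im₂ x)
    ℤ.+ ((c ℤ.+ c) ℤ.* (c ℤ.+ c) ℤ.+ (d ℤ.+ d) ℤ.* (d ℤ.+ d))
    ≡⟨ cong₂ ℤ._+_ (cong₂ ℤ._+_ (double (re₂ x)) (double (im₂ x)))
         (cong₂ ℤ._+_ (i*i≡+square (c ℤ.+ c)) (i*i≡+square (d ℤ.+ d))) ⟩
  + eightfold x ∎
  where
  open ≡-Reasoning
  open ℤ-Solver
  double : ∀ i → + 2 ℤ.* (i ℤ.* i) ≡ + (2 ℕ.* square i)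
  double i = trans (cong (+ 2 ℤ.*_) (i*i≡+square i)) (sym (ℤ.pos-* 2 (square i)))

8*‖‖ : ∀ x → 8 ℕ.* ‖ x ‖ ≡ eightfold x
8*‖‖ x = trans (sym (ℤ.abs-* (+ 8) (norm x))) (cong ∣_∣ (8*norm x))

norm≡+‖‖ : ∀ x → norm x ≡ + ‖ x ‖
norm≡+‖‖ x = nonneg (norm x) (8*norm x)
  where
  nonneg : ∀ i {k} → + 8 ℤ.* i ≡ + k → i ≡ + ∣ i ∣
  -- For a negative i the product 8 i would be negative, so no other case remains.
  nonneg (+ _) _ = refl

square≡0 : ∀ i → square i ≡ 0 → i ≡ 0ℤ
square≡0 i eq = ℤ.∣i∣≡0⇒i≡0 ([ (λ e → e) , (λ e → e) ]′ (ℕ.m*n≡0⇒m≡0∨n≡0 ∣ i ∣ eq))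

i+i≡0⇒i≡0 : ∀ i → i ℤ.+ i ≡ 0ℤ → i ≡ 0ℤ
i+i≡0⇒i≡0 (+ 0) _ = refl

-- Every square in `eightfold` vanishes. First c = d = 0, after which `re₂` and `im₂` reduce to 2a
-- and 2b.
‖x‖≡0⇒x≡0 : ∀ x → ‖ x ‖ ≡ 0 → x ≡ scalar 0ℤ
‖x‖≡0⇒x≡0 x@(coords a b c d) eq = coords-cong
  (i+i≡0⇒i≡0 a (vanish a (square≡0 (re₂ x) (ℕ.m+n≡0⇒m≡0 (square (re₂ x)) (ℕ.m+n≡0⇒m≡0 _ e₁₂)))))
  (i+i≡0⇒i≡0 b (vanish b (square≡0 (im₂ x) (ℕ.m+n≡0⇒m≡0 (square (im₂ x))
    (ℕ.m+n≡0⇒n≡0 (2 ℕ.* square (re₂ x)) e₁₂)))))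
  c≡0 d≡0
  where
  e = trans (sym (8*‖‖ x)) (trans (cong (8 ℕ.*_) eq) (ℕ.*-zeroʳ 8))
  e₁₂ = ℕ.m+n≡0⇒m≡0 (2 ℕ.* square (re₂ x) ℕ.+ 2 ℕ.* square (im₂ x)) e
  e₃₄ = ℕ.m+n≡0⇒n≡0 (2 ℕ.* square (re₂ x) ℕ.+ 2 ℕ.* square (im₂ x)) e
  c≡0 = i+i≡0⇒i≡0 c (square≡0 (c ℤ.+ c) (ℕ.m+n≡0⇒m≡0 _ e₃₄))
  d≡0 = i+i≡0⇒i≡0 d (square≡0 (d ℤ.+ d) (ℕ.m+n≡0⇒n≡0 (square (c ℤ.+ c)) e₃₄))
  vanish : ∀ i → i ℤ.+ i ℤ.+ (c ℤ.+ d) ≡ 0ℤ → i ℤ.+ i ≡ 0ℤ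
  vanish i = trans (sym (trans (cong (λ j → i ℤ.+ i ℤ.+ j) (cong₂ ℤ._+_ c≡0 d≡0)) (ℤ.+-identityʳ _)))

-- Division with remainder

-- Dividing t + n by 2n leaves r with 0 ≤ r < 2n, and t - 2nq = r - n. The bound follows from (r -
-- n)² + r (2n - r) = n².
centredRemainder : ∀ t n .{{_ : NonZero n}} →
  ∃[ q ] square (t ℤ.- q ℤ.* (+ n ℤ.+ + n)) ≤ n ℕ.* n
centredRemainder t n@(suc _) = q , ℕ.m+n≤o⇒m≤o _ (ℕ.≤-reflexive (ℤ.+-injective (begin
  + (square (t ℤ.- q ℤ.* (+ n ℤ.+ + n)) ℕ.+ r ℕ.* s)
    ≡⟨ cong₂ ℤ._+_ (sym (i*i≡+square (t ℤ.- q ℤ.* (+ n ℤ.+ + n)))) (ℤ.pos-* r s) ⟩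
  (t ℤ.- q ℤ.* (+ n ℤ.+ + n)) ℤ.* (t ℤ.- q ℤ.* (+ n ℤ.+ + n)) ℤ.+ + r ℤ.* + s
    ≡⟨ cong₂ (λ u v → u ℤ.* u ℤ.+ + r ℤ.* v) t-2nq s≡ ⟩
  (+ r ℤ.- + n) ℤ.* (+ r ℤ.- + n) ℤ.+ + r ℤ.* (+ n ℤ.+ + n ℤ.- + r)
    ≡⟨ solve 2 (λ r n → (r :- n) :* (r :- n) :+ r :* (n :+ n :- r) := n :* n) refl (+ r) (+ n) ⟩
  + n ℤ.* + n
    ≡⟨ ℤ.pos-* n n ⟨
  + (n ℕ.* n) ∎)))
  where
  open ≡-Reasoning
  open ℤ-Solver
  q = (t ℤ.+ + n) /ℕ (n ℕ.+ n)
  r = (t ℤ.+ + n) %ℕ (n ℕ.+ n)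
  s = n ℕ.+ n ℕ.∸ r
  s≡ : + s ≡ + n ℤ.+ + n ℤ.- + r
  s≡ = trans (sym (ℤ.⊖-≥ (ℕ.<⇒≤ (n%ℕd<d (t ℤ.+ + n) (n ℕ.+ n))))) (sym (ℤ.m-n≡m⊖n (n ℕ.+ n) r))
  t-2nq : t ℤ.- q ℤ.* (+ n ℤ.+ + n) ≡ + r ℤ.- + n
  t-2nq = begin
    t ℤ.- q ℤ.* (+ n ℤ.+ + n)
      ≡⟨ solve 3 (λ t m n → t :- m := t :+ n :- m :- n) refl t (q ℤ.* (+ n ℤ.+ + n)) (+ n) ⟩
    (t ℤ.+ + n) ℤ.- q ℤ.* (+ n ℤ.+ + n) ℤ.- + n
      ≡⟨ cong (λ u → u ℤ.- q ℤ.* (+ n ℤ.+ + n) ℤ.- + n) (a≡a%ℕn+[a/ℕn]*n (t ℤ.+ + n) (n ℕ.+ n)) ⟩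
    + r ℤ.+ q ℤ.* (+ n ℤ.+ + n) ℤ.- q ℤ.* (+ n ℤ.+ + n) ℤ.- + n
      ≡⟨ solve 3 (λ r m n → r :+ m :- m :- n := r :- n) refl (+ r) (q ℤ.* (+ n ℤ.+ + n)) (+ n) ⟩
    + r ℤ.- + n ∎

-- The weights in `eightfold` add up to 2 + 2 + 1 + 1 = 6 < 8, so the norm is at most ¾ n².
smallNorm : ∀ y n .{{_ : NonZero n}} →
  square (re₂ y) ≤ n ℕ.* n → square (im₂ y) ≤ n ℕ.* n →
  square (c₃ y ℤ.+ c₃ y) ≤ n ℕ.* n → square (c₄ y ℤ.+ c₄ y) ≤ n ℕ.* n →
  ‖ y ‖ < n ℕ.* n
smallNorm y n b₁ b₂ b₃ b₄ = ℕ.*-cancelˡ-< 8 ‖ y ‖ m (begin-strict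
  8 ℕ.* ‖ y ‖ ≡⟨ 8*‖‖ y ⟩
  eightfold y
    ≤⟨ ℕ.+-mono-≤ (ℕ.+-mono-≤ (ℕ.*-monoʳ-≤ 2 b₁) (ℕ.*-monoʳ-≤ 2 b₂)) (ℕ.+-mono-≤ b₃ b₄) ⟩
  2 ℕ.* m ℕ.+ 2 ℕ.* m ℕ.+ (m ℕ.+ m)
    ≡⟨ solve 1 (λ m → con 2 :* m :+ con 2 :* m :+ (m :+ m) := con 6 :* m) refl m ⟩
  6 ℕ.* m <⟨ ℕ.*-monoˡ-< m {{ℕ.m*n≢0 n n}} (ℕ.m≤m+n 7 1) ⟩
  8 ℕ.* m ∎)
  where
  open ℕ-Solver
  open ℕ.≤-Reasoning
  m = n ℕ.* n

-- c and d are reduced first, since they enter the doubled first two coordinates.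
smallResidue : ∀ x n .{{_ : NonZero n}} → ∃[ q ] ‖ x -ᶜ + n • q ‖ < n ℕ.* n
smallResidue x@(coords a b c d) n = coords q₁ q₂ q₃ q₄ ,
  smallNorm (x -ᶜ + n • coords q₁ q₂ q₃ q₄) n
    (bound (rest a q₁) (proj₂ (centredRemainder (a ℤ.+ a ℤ.+ s) n)))
    (bound (rest b q₂) (proj₂ (centredRemainder (b ℤ.+ b ℤ.+ s) n)))
    (bound (double c q₃) (proj₂ (centredRemainder (c ℤ.+ c) n)))
    (bound (double d q₄) (proj₂ (centredRemainder (d ℤ.+ d) n)))
  where
  open ℤ-Solver
  q₁ q₂ q₃ q₄ s : ℤ
  q₃ = proj₁ (centredRemainder (c ℤ.+ c) n)
  q₄ = proj₁ (centredRemainder (d ℤ.+ d) n)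
  s = c ℤ.- + n ℤ.* q₃ ℤ.+ (d ℤ.- + n ℤ.* q₄)
  q₁ = proj₁ (centredRemainder (a ℤ.+ a ℤ.+ s) n)
  q₂ = proj₁ (centredRemainder (b ℤ.+ b ℤ.+ s) n)
  bound : ∀ {i j} → i ≡ j → square i ≤ n ℕ.* n → square j ≤ n ℕ.* n
  bound refl i²≤n² = i²≤n²
  double : ∀ i q → i ℤ.+ i ℤ.- q ℤ.* (+ n ℤ.+ + n) ≡ (i ℤ.- + n ℤ.* q) ℤ.+ (i ℤ.- + n ℤ.* q)
  double i q = solve 3 (λ i q n → i :+ i :- q :* (n :+ n) := (i :- n :* q) :+ (i :- n :* q))
    refl i q (+ n)
  rest : ∀ i q →
    i ℤ.+ i ℤ.+ s ℤ.- q ℤ.* (+ n ℤ.+ + n) ≡ (i ℤ.- + n ℤ.* q) ℤ.+ (i ℤ.- + n ℤ.* q) ℤ.+ s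
  rest i q = solve 4 (λ i q n s →
    i :+ i :+ s :- q :* (n :+ n) := (i :- n :* q) :+ (i :- n :* q) :+ s) refl i q (+ n) s

-ᶜ-·-conj : ∀ (α q β : Coords ℤ) → (α -ᶜ q · β) · conjᶜ β ≡ α · conjᶜ β -ᶜ norm β • q
-ᶜ-·-conj α q β = ℤᶜ.solveᶜ (α ∷ q ∷ β ∷ []) (λ { (α ∷ q ∷ β ∷ []) →
  (α -ᶜ q · β) · conjᶜ β , α · conjᶜ β -ᶜ norm β • q }) refl

‖‖-cancelʳ-< : ∀ ρ β → ‖ ρ · conjᶜ β ‖ < ‖ β ‖ ℕ.* ‖ β ‖ → ‖ ρ ‖ < ‖ β ‖
‖‖-cancelʳ-< ρ β = ℕ.*-cancelʳ-< (‖ β ‖) (‖ ρ ‖) (‖ β ‖)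
  ∘ subst (_< ‖ β ‖ ℕ.* ‖ β ‖) (trans (‖‖-· ρ (conjᶜ β)) (cong (‖ ρ ‖ ℕ.*_) (‖‖-conj β)))

-- The quotient q rounds α · `conjᶜ β` divided by the integer `norm β`. The remainder times
-- `conjᶜ β` then has norm below ‖β‖², and one factor ‖β‖ cancels.
division : ∀ α β .{{_ : NonZero ‖ β ‖}} → ∃[ q ] ‖ α -ᶜ q · β ‖ < ‖ β ‖
division α β =
  let q , small = smallResidue (α · conjᶜ β) ‖ β ‖
      eq : α · conjᶜ β -ᶜ + ‖ β ‖ • q ≡ (α -ᶜ q · β) · conjᶜ β
      eq = trans (cong (λ n → α · conjᶜ β -ᶜ n • q) (sym (norm≡+‖‖ β))) (sym (-ᶜ-·-conj α q β))
  in q , ‖‖-cancelʳ-< (α -ᶜ q · β) β (subst (λ γ → ‖ γ ‖ < ‖ β ‖ ℕ.* ‖ β ‖) eq small)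

-- Right gcds by Euclid's algorithm

bezout-base : ∀ (α β : Coords ℤ) → scalar 1ℤ · α +ᶜ scalar 0ℤ · β ≡ α
bezout-base α β = ℤᶜ.solveᶜ (α ∷ β ∷ [])
  (λ { (α ∷ β ∷ []) → scalar (con 1ℤ) · α +ᶜ scalar (con 0ℤ) · β , α }) refl
  where open ℤ-Solver using (con)

·-distribˡ-- : ∀ (x y z : Coords ℤ) → x · (y -ᶜ z) ≡ x · y -ᶜ x · z
·-distribˡ-- x y z = ℤᶜ.solveᶜ (x ∷ y ∷ z ∷ [])
  (λ { (x ∷ y ∷ z ∷ []) → x · (y -ᶜ z) , x · y -ᶜ x · z }) refl

·-distribʳ-- : ∀ (x y z : Coords ℤ) → (y -ᶜ z) · x ≡ y · x -ᶜ z · x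
·-distribʳ-- x y z = ℤᶜ.solveᶜ (x ∷ y ∷ z ∷ [])
  (λ { (x ∷ y ∷ z ∷ []) → (y -ᶜ z) · x , y · x -ᶜ z · x }) refl

·-distribʳ-+ : ∀ (x y z : Coords ℤ) → (y +ᶜ z) · x ≡ y · x +ᶜ z · x
·-distribʳ-+ x y z = ℤᶜ.solveᶜ (x ∷ y ∷ z ∷ [])
  (λ { (x ∷ y ∷ z ∷ []) → (y +ᶜ z) · x , y · x +ᶜ z · x }) refl

x+[y-z]≡y+[x-z] : ∀ (x y z : Coords ℤ) → x +ᶜ (y -ᶜ z) ≡ y +ᶜ (x -ᶜ z)
x+[y-z]≡y+[x-z] x y z = ℤᶜ.solveᶜ (x ∷ y ∷ z ∷ [])
  (λ { (x ∷ y ∷ z ∷ []) → x +ᶜ (y -ᶜ z) , y +ᶜ (x -ᶜ z) }) refl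

x≡[x-y]+y : ∀ (x y : Coords ℤ) → x ≡ (x -ᶜ y) +ᶜ y
x≡[x-y]+y x y = ℤᶜ.solveᶜ (x ∷ y ∷ []) (λ { (x ∷ y ∷ []) → x , (x -ᶜ y) +ᶜ y }) refl

bezout-step : ∀ (α β q x y : Coords ℤ) →
  y · α +ᶜ (x -ᶜ y · q) · β ≡ x · β +ᶜ y · (α -ᶜ q · β)
bezout-step α β q x y = begin
  y · α +ᶜ (x -ᶜ y · q) · β        ≡⟨ cong (y · α +ᶜ_) (·-distribʳ-- β x (y · q)) ⟩
  y · α +ᶜ (x · β -ᶜ (y · q) · β)  ≡⟨ x+[y-z]≡y+[x-z] (y · α) (x · β) ((y · q) · β) ⟩
  x · β +ᶜ (y · α -ᶜ (y · q) · β)  ≡⟨ cong (λ z → x · β +ᶜ (y · α -ᶜ z)) (·-assoc y q β) ⟩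
  x · β +ᶜ (y · α -ᶜ y · (q · β))  ≡⟨ cong (x · β +ᶜ_) (·-distribˡ-- y α (q · β)) ⟨
  x · β +ᶜ y · (α -ᶜ q · β)        ∎
  where open ≡-Reasoning

divisor-step : ∀ (b q a δ : Coords ℤ) → b · δ +ᶜ q · (a · δ) ≡ (b +ᶜ q · a) · δ
divisor-step b q a δ = trans (cong (b · δ +ᶜ_) (sym (·-assoc q a δ)))
  (sym (·-distribʳ-+ δ b (q · a)))

-- The fields say that δ generates the left ideal spanned by α and β.
record RightGCD (α β : Coords ℤ) : Set where
  field
    δ x y a b : Coords ℤ
    bezout    : x · α +ᶜ y · β ≡ δ
    α≡aδ      : α ≡ a · δ
    β≡bδ      : β ≡ b · δ

rightGCD : ∀ α β → RightGCD α β
rightGCD α β = go α β (<-wellFounded ‖ β ‖)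
  where
  zeroCase : ∀ α β → ‖ β ‖ ≡ 0 → RightGCD α β
  zeroCase α β ‖β‖≡0 = record
    { δ = α ; x = scalar 1ℤ ; y = scalar 0ℤ ; a = scalar 1ℤ ; b = scalar 0ℤ
    ; bezout = bezout-base α β
    ; α≡aδ = sym (trans (scalar-· 1ℤ α) (1•x≡x α))
    ; β≡bδ = trans (‖x‖≡0⇒x≡0 β ‖β‖≡0) (sym (scalar-· 0ℤ α))
    }
  step : ∀ α β q → RightGCD β (α -ᶜ q · β) → RightGCD α β
  step α β q g = record
    -- Here β = a δ and α - q β = b δ, so α = (b + q a) δ, while δ = x β + y (α - q β) regroups to y
    -- α + (x - y q) β.
    { δ = δ ; x = y ; y = x -ᶜ y · q ; a = b +ᶜ q · a ; b = a
    ; bezout = trans (bezout-step α β q x y) bezout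
    ; α≡aδ = begin
        α                        ≡⟨ x≡[x-y]+y α (q · β) ⟩
        (α -ᶜ q · β) +ᶜ q · β    ≡⟨ cong₂ (λ u v → u +ᶜ q · v) β≡bδ α≡aδ ⟩
        b · δ +ᶜ q · (a · δ)     ≡⟨ divisor-step b q a δ ⟩
        (b +ᶜ q · a) · δ         ∎
    ; β≡bδ = α≡aδ
    }
    where
    open ≡-Reasoning
    open RightGCD g
  go : ∀ α β → Acc _<_ ‖ β ‖ → RightGCD α β
  go α β (acc rec) with ‖ β ‖ ℕ.≟ 0
  ... | yes ‖β‖≡0 = zeroCase α β ‖β‖≡0
  ... | no ‖β‖≢0 =
    let q , r<β = division α β {{ℕ.≢-nonZero ‖β‖≢0}} in
    step α β q (go β (α -ᶜ q · β) (rec r<β))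

conj-·-cancel : ∀ {a} x → ‖ a ‖ ≡ 1 → conjᶜ a · (a · x) ≡ x
conj-·-cancel {a} x ‖a‖≡1 = begin
  conjᶜ a · (a · x) ≡⟨ ·-assoc (conjᶜ a) a x ⟨
  conjᶜ a · a · x   ≡⟨ cong (_· x) (conj-· a) ⟩
  scalar (norm a) · x ≡⟨ scalar-· (norm a) x ⟩
  norm a • x        ≡⟨ cong (_• x) (trans (norm≡+‖‖ a) (cong +_ ‖a‖≡1)) ⟩
  1ℤ • x            ≡⟨ 1•x≡x x ⟩
  x                 ∎
  where open ≡-Reasoning

-- The Bézout identity reads δ = x z + p y, and the multiple of p does not affect the norm mod p.
-- For prime p this keeps δ from being a unit.
p∣‖gcd‖ : ∀ {p z} → p ∣ ‖ z ‖ → (g : RightGCD z (scalar (+ p))) → p ∣ ‖ RightGCD.δ g ‖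
p∣‖gcd‖ {p} {z} p∣z g = ∣⇒∣ᵤ (subst (+ p ℤ.∣_) eq
  (ℤ.∣m∣n⇒∣m+n {+ p} {norm (x · z)}
    (∣ᵤ⇒∣ (subst (p ∣_) (sym (‖‖-· x z)) (ℕ.∣n⇒∣m*n (‖ x ‖) p∣z)))
    (ℤ.∣m⇒∣m*n (polar (x · z) y ℤ.+ + p ℤ.* norm y) ℤ.∣-refl)))
  where
  open RightGCD g
  eq : norm (x · z) ℤ.+ + p ℤ.* (polar (x · z) y ℤ.+ + p ℤ.* norm y) ≡ norm δ
  eq = trans (sym (norm-+• (x · z) (+ p) y))
    (cong norm (trans (cong (x · z +ᶜ_) (sym (·-scalar y (+ p)))) bezout))

-- Solving 1 + x² + y² ≡ 0 mod p

congruent : ∀ i j p .{{_ : NonZero p}} → i %ℕ p ≡ j %ℕ p → + p ℤ.∣ i ℤ.- j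
congruent i j p eq = divides (i /ℕ p ℤ.- j /ℕ p) (begin
  i ℤ.- j
    ≡⟨ cong₂ ℤ._-_ (a≡a%ℕn+[a/ℕn]*n i p) (a≡a%ℕn+[a/ℕn]*n j p) ⟩
  (+ (i %ℕ p) ℤ.+ i /ℕ p ℤ.* + p) ℤ.- (+ (j %ℕ p) ℤ.+ j /ℕ p ℤ.* + p)
    ≡⟨ cong (λ r → (+ r ℤ.+ i /ℕ p ℤ.* + p) ℤ.- (+ (j %ℕ p) ℤ.+ j /ℕ p ℤ.* + p)) eq ⟩
  (+ (j %ℕ p) ℤ.+ i /ℕ p ℤ.* + p) ℤ.- (+ (j %ℕ p) ℤ.+ j /ℕ p ℤ.* + p)
    ≡⟨ solve 4 (λ r a b p → (r :+ a :* p) :- (r :+ b :* p) := (a :- b) :* p)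
         refl (+ (j %ℕ p)) (i /ℕ p) (j /ℕ p) (+ p) ⟩
  (i /ℕ p ℤ.- j /ℕ p) ℤ.* + p ∎)
  where
  open ≡-Reasoning
  open ℤ-Solver

-- The prime p would divide b - a or b + a, but both lie strictly between 0 and p, as a < b ≤ h
-- gives b + a < 2h ≤ p.
distinctSquares : ∀ {p h a b} → Prime p → h ℕ.+ h ≤ p → a < b → b ≤ h →
  ¬ (+ p ℤ.∣ + b ℤ.* + b ℤ.- + a ℤ.* + a)
distinctSquares {p} {h} {a} {b} pr 2h≤p a<b b≤h p∣ =
  [ absurd (ℕ.m<n⇒0<n∸m a<b) (ℕ.≤-<-trans (ℕ.m∸n≤m b a) (ℕ.≤-<-trans (ℕ.m≤m+n b a) b+a<p))
  , absurd (ℕ.<-≤-trans (ℕ.m<n⇒0<n a<b) (ℕ.m≤m+n b a)) b+a<p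
  ]′ (euclidsLemma (b ℕ.∸ a) (b ℕ.+ a) pr (subst (p ∣_) factors (∣⇒∣ᵤ p∣)))
  where
  open ≡-Reasoning
  b+a<p : b ℕ.+ a < p
  b+a<p = ℕ.<-≤-trans (ℕ.+-monoʳ-< b a<b) (ℕ.≤-trans (ℕ.+-mono-≤ b≤h b≤h) 2h≤p)
  absurd : ∀ {d} → 0 < d → d < p → ¬ (p ∣ d)
  absurd 0<d d<p p∣d = ℕ.<⇒≱ d<p (ℕ.∣⇒≤ {{ℕ.>-nonZero 0<d}} p∣d)
  factors : ∣ + b ℤ.* + b ℤ.- + a ℤ.* + a ∣ ≡ (b ℕ.∸ a) ℕ.* (b ℕ.+ a)
  factors = begin
    ∣ + b ℤ.* + b ℤ.- + a ℤ.* + a ∣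
      ≡⟨ cong ∣_∣ (solve 2 (λ a b → b :* b :- a :* a := (b :- a) :* (b :+ a)) refl (+ a) (+ b)) ⟩
    ∣ (+ b ℤ.- + a) ℤ.* (+ b ℤ.+ + a) ∣
      ≡⟨ ℤ.abs-* (+ b ℤ.- + a) (+ b ℤ.+ + a) ⟩
    ∣ + b ℤ.- + a ∣ ℕ.* (b ℕ.+ a)
      ≡⟨ cong (λ i → ∣ i ∣ ℕ.* (b ℕ.+ a)) (trans (ℤ.m-n≡m⊖n b a) (ℤ.⊖-≥ (ℕ.<⇒≤ a<b))) ⟩
    (b ℕ.∸ a) ℕ.* (b ℕ.+ a) ∎
    where open ℤ-Solver

-- Among the p + 1 or p + 2 integers x² and −1 − y² with 0 ≤ x, y ≤ ⌊p/2⌋ two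
-- are congruent mod p, and two of the same kind never are.
p∣1+x²+y² : ∀ {p} → Prime p → ∃[ x ] ∃[ y ] + p ℤ.∣ 1ℤ ℤ.+ x ℤ.* x ℤ.+ y ℤ.* y
p∣1+x²+y² {p} pr = conclude
  (Fin.pigeonhole p<2h+2 residue)
  where
  instance _ = prime⇒nonZero pr
  h = p ℕ./ 2
  p≡ : p ≡ p ℕ.% 2 ℕ.+ h ℕ.* 2
  p≡ = m≡m%n+[m/n]*n p 2
  h*2≡h+h : h ℕ.* 2 ≡ h ℕ.+ h
  h*2≡h+h = trans (ℕ.*-comm h 2) (cong (h ℕ.+_) (ℕ.+-identityʳ h))
  2h≤p : h ℕ.+ h ≤ p
  2h≤p = subst₂ _≤_ h*2≡h+h (sym p≡) (ℕ.m≤n+m (h ℕ.* 2) (p ℕ.% 2))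
  p<2h+2 : p < suc h ℕ.+ suc h
  p<2h+2 = subst₂ _<_ (sym p≡) (trans (cong (2 ℕ.+_) h*2≡h+h) (cong suc (sym (ℕ.+-suc h h))))
    (ℕ.+-monoˡ-< (h ℕ.* 2) (m%n<n p 2))
  Sample = Fin (suc h) ⊎ Fin (suc h)
  sq : Fin (suc h) → ℤ
  sq a = + toℕ a ℤ.* + toℕ a
  value : Sample → ℤ
  value (inj₁ a) = sq a
  value (inj₂ b) = ℤ.- (1ℤ ℤ.+ sq b)
  residue : Fin (suc h ℕ.+ suc h) → Fin p
  residue i = fromℕ< (n%ℕd<d (value (splitAt (suc h) i)) p)
  _~_ : Sample → Sample → Set
  s ~ t = + p ℤ.∣ value s ℤ.- value t
  -- Both signs of the difference are supplied, because `distinctSquares` wants the larger square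
  -- first.
  injective : ∀ a b → + p ℤ.∣ sq a ℤ.- sq b → + p ℤ.∣ sq b ℤ.- sq a → a ≡ b
  injective a b p∣a-b p∣b-a with ℕ.<-cmp (toℕ a) (toℕ b)
  ... | tri< a<b _ _ = contradiction p∣b-a (distinctSquares pr 2h≤p a<b (Fin.toℕ≤pred[n] b))
  ... | tri≈ _ a≡b _ = Fin.toℕ-injective a≡b
  ... | tri> _ _ b<a = contradiction p∣a-b (distinctSquares pr 2h≤p b<a (Fin.toℕ≤pred[n] a))
  negated : ∀ a b → value (inj₂ a) ℤ.- value (inj₂ b) ≡ sq b ℤ.- sq a
  negated a b = solve 2 (λ a b → :- (con 1ℤ :+ a) :- (:- (con 1ℤ :+ b)) := b :- a) refl (sq a) (sq b)
    where open ℤ-Solver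
  mixed : ∀ a b → inj₁ a ~ inj₂ b → + p ℤ.∣ 1ℤ ℤ.+ sq a ℤ.+ sq b
  mixed a b = subst (+ p ℤ.∣_) (solve 2 (λ a b →
    a :- (:- (con 1ℤ :+ b)) := con 1ℤ :+ a :+ b) refl (sq a) (sq b))
    where open ℤ-Solver
  Solution = ∃[ x ] ∃[ y ] + p ℤ.∣ 1ℤ ℤ.+ x ℤ.* x ℤ.+ y ℤ.* y
  collision : ∀ s t → s ≢ t → s ~ t → t ~ s → Solution
  collision (inj₁ a) (inj₁ b) s≢t s~t t~s = contradiction (cong inj₁ (injective a b s~t t~s)) s≢t
  collision (inj₁ a) (inj₂ b) s≢t s~t t~s = + toℕ a , + toℕ b , mixed a b s~t
  collision (inj₂ a) (inj₁ b) s≢t s~t t~s = + toℕ b , + toℕ a , mixed b a t~s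
  collision (inj₂ a) (inj₂ b) s≢t s~t t~s = contradiction (cong inj₂ (injective a b
    (subst (+ p ℤ.∣_) (negated b a) t~s) (subst (+ p ℤ.∣_) (negated a b) s~t))) s≢t
  conclude : (∃[ i ] ∃[ j ] i Fin.< j × residue i ≡ residue j) → Solution
  conclude (i , j , i<j , eq) = collision (splitAt (suc h) i) (splitAt (suc h) j)
    -- `join` inverts `splitAt`, so distinct indices yield distinct samples.
    (λ eq → Fin.<⇒≢ i<j (trans (sym (Fin.join-splitAt (suc h) (suc h) i))
      (trans (cong (join (suc h) (suc h)) eq) (Fin.join-splitAt (suc h) (suc h) j))))
    (congruent u v p u≡v) (congruent v u p (sym u≡v))
    where
    u = value (splitAt (suc h) i)
    v = value (splitAt (suc h) j)
    u≡v : u %ℕ p ≡ v %ℕ p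
    u≡v = Fin.fromℕ<-injective _ _ (n%ℕd<d u p) (n%ℕd<d v p) eq

-- Irreducible elements have prime norm

Irreducibleᶜ : Coords ℤ → Set
Irreducibleᶜ z = ∀ a b → z ≡ a · b → ‖ a ‖ ≡ 1 ⊎ ‖ b ‖ ≡ 1

¬p∣1 : ∀ {p n} → Prime p → p ∣ n → n ≢ 1
¬p∣1 pr p∣n refl with refl ← ℕ.∣1⇒≡1 p∣n = ¬prime[1] pr

-- A b of norm 1 is inverted by its conjugate, so δ = `conjᶜ b` · β and every left multiple of δ is
-- one of β.
multiple : ∀ {α β} (g : RightGCD α β) → let open RightGCD g in
  ‖ b ‖ ≡ 1 → α ≡ (a · conjᶜ b) · β
multiple {α} {β} g ‖b‖≡1 = begin
  α                        ≡⟨ α≡aδ ⟩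
  a · δ                    ≡⟨ cong (a ·_) (conj-·-cancel {b} δ ‖b‖≡1) ⟨
  a · (conjᶜ b · (b · δ))  ≡⟨ cong (λ v → a · (conjᶜ b · v)) β≡bδ ⟨
  a · (conjᶜ b · β)        ≡⟨ ·-assoc a (conjᶜ b) β ⟨
  (a · conjᶜ b) · β        ∎
  where
  open ≡-Reasoning
  open RightGCD g

p∣c₁ : ∀ {p t} e → t ≡ + p • e → p ∣ ∣ c₁ t ∣
p∣c₁ {p} e refl = ∣⇒∣ᵤ {+ p} {+ p ℤ.* c₁ e} (ℤ.∣m⇒∣m*n (c₁ e) ℤ.∣-refl)

-- A gcd of p and 1 + x i + y (v₄ − v₃), whose norm 1 + x² + y² is divisible
-- by p, is a proper divisor of p.
¬irreducible-unit·p : ∀ {p} u → Prime p → ‖ u ‖ ≡ 1 → ¬ Irreducibleᶜ (u · scalar (+ p))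
¬irreducible-unit·p {p} u pr ‖u‖≡1 irr =
  let x , y , p∣ = p∣1+x²+y² pr in
  refute (coords 1ℤ x (ℤ.- y) y) refl (subst (p ∣_) (cong ∣_∣ (norm-t x y)) (∣⇒∣ᵤ p∣))
  where
  norm-t : ∀ x y → 1ℤ ℤ.+ x ℤ.* x ℤ.+ y ℤ.* y ≡ norm (coords 1ℤ x (ℤ.- y) y)
  norm-t = solve 2 (λ x y →
    con 1ℤ :+ x :* x :+ y :* y := norm (coords (con 1ℤ) x (:- y) y)) refl
    where open ℤ-Solver
  refute : ∀ t → c₁ t ≡ 1ℤ → ¬ (p ∣ ‖ t ‖)
  refute t c₁t≡1 p∣‖t‖ = [ b-unit , ¬p∣1 pr (p∣‖gcd‖ p∣‖t‖ g) ]′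
    (irr (u · b) δ (trans (cong (u ·_) β≡bδ) (sym (·-assoc u b δ))))
    where
    g = rightGCD t (scalar (+ p))
    open RightGCD g
    -- If b were a unit, t would be a multiple of p, but its first coordinate is 1.
    b-unit : ‖ u · b ‖ ≢ 1
    b-unit ‖ub‖≡1 = ¬p∣1 pr (p∣c₁ (a · conjᶜ b) t≡pe) (cong ∣_∣ c₁t≡1)
      where
      ‖b‖≡1 : ‖ b ‖ ≡ 1
      ‖b‖≡1 = ℕ.m*n≡1⇒n≡1 (‖ u ‖) (‖ b ‖) (trans (sym (‖‖-· u b)) ‖ub‖≡1)
      t≡pe : t ≡ + p • (a · conjᶜ b)
      t≡pe = trans (multiple g ‖b‖≡1) (·-scalar (a · conjᶜ b) (+ p))

irreducible⇒‖‖≡p : ∀ {p z} → Prime p → p ∣ ‖ z ‖ → Irreducibleᶜ z → ‖ z ‖ ≡ p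
irreducible⇒‖‖≡p {p} {z} pr p∣z irr =
  [ a-unit , (λ ‖δ‖≡1 → contradiction ‖δ‖≡1 (¬p∣1 pr (p∣‖gcd‖ p∣z g))) ]′ (irr a δ α≡aδ)
  where
  open ≡-Reasoning
  instance _ = prime⇒nonZero pr
  g = rightGCD z (scalar (+ p))
  open RightGCD g
  m = ℕ.quotient p∣z
  ‖z‖≡mp : ‖ z ‖ ≡ m ℕ.* p
  ‖z‖≡mp = ℕ.m∣n⇒n≡quotient*m p∣z
  a-unit : ‖ a ‖ ≡ 1 → ‖ z ‖ ≡ p
  -- As p = ‖b‖ m, either m = 1 and ‖z‖ = p, or m = p. In the second case b is a unit and z = (a ·
  -- `conjᶜ b`) · p, which is not irreducible.
  a-unit ‖a‖≡1 = [ (λ m≡1 → trans ‖z‖≡mp (trans (cong (ℕ._* p) m≡1) (ℕ.*-identityˡ p)))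
                 , (λ m≡p → contradiction (subst Irreducibleᶜ (multiple g (‖b‖≡1 m≡p)) irr)
                     (¬irreducible-unit·p (a · conjᶜ b) pr (trans (‖‖-· a (conjᶜ b))
                       (cong₂ ℕ._*_ ‖a‖≡1 (trans (‖‖-conj b) (‖b‖≡1 m≡p))))))
                 ]′ (prime⇒irreducible pr (ℕ.divides (‖ b ‖) p≡‖b‖m))
    where
    p≡‖b‖m : p ≡ ‖ b ‖ ℕ.* m
    -- Since ‖a‖ = 1, the norms of δ and z agree, whence p² = ‖b‖ ‖z‖ = ‖b‖ m p.
    p≡‖b‖m = ℕ.*-cancelʳ-≡ p (‖ b ‖ ℕ.* m) p (begin
      p ℕ.* p                  ≡⟨ ‖‖-scalar p ⟨
      ‖ scalar (+ p) ‖         ≡⟨ cong ‖_‖ β≡bδ ⟩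
      ‖ b · δ ‖                ≡⟨ ‖‖-· b δ ⟩
      ‖ b ‖ ℕ.* ‖ δ ‖          ≡⟨ cong (‖ b ‖ ℕ.*_) (ℕ.*-identityˡ (‖ δ ‖)) ⟨
      ‖ b ‖ ℕ.* (1 ℕ.* ‖ δ ‖)  ≡⟨ cong (λ n → ‖ b ‖ ℕ.* (n ℕ.* ‖ δ ‖)) ‖a‖≡1 ⟨
      ‖ b ‖ ℕ.* (‖ a ‖ ℕ.* ‖ δ ‖) ≡⟨ cong (‖ b ‖ ℕ.*_) (‖‖-· a δ) ⟨
      ‖ b ‖ ℕ.* ‖ a · δ ‖      ≡⟨ cong (λ v → ‖ b ‖ ℕ.* ‖ v ‖) α≡aδ ⟨
      ‖ b ‖ ℕ.* ‖ z ‖          ≡⟨ cong (‖ b ‖ ℕ.*_) ‖z‖≡mp ⟩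
      ‖ b ‖ ℕ.* (m ℕ.* p)      ≡⟨ ℕ.*-assoc (‖ b ‖) m p ⟨
      ‖ b ‖ ℕ.* m ℕ.* p        ∎)
    ‖b‖≡1 : m ≡ p → ‖ b ‖ ≡ 1
    ‖b‖≡1 m≡p = ℕ.*-cancelʳ-≡ (‖ b ‖) 1 p (begin
      ‖ b ‖ ℕ.* p ≡⟨ cong (‖ b ‖ ℕ.*_) m≡p ⟨
      ‖ b ‖ ℕ.* m ≡⟨ p≡‖b‖m ⟨
      p           ≡⟨ ℕ.*-identityˡ p ⟨
      1 ℕ.* p     ∎)

primeDivisor : ∀ n → n ≢ 0 → n ≢ 1 → ∃[ p ] (Prime p × p ∣ n)
primeDivisor n n≢0 n≢1 with factorise n {{ℕ.≢-nonZero n≢0}}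
... | record { factors = [] ; isFactorisation = n≡1 } = contradiction n≡1 n≢1
... | record { factors = p ∷ ps ; isFactorisation = n≡ ; factorsPrime = pr ∷ _ } =
  p , pr , subst (p ∣_) (sym n≡) (ℕ.m∣m*n (product ps))

-- Units, and the two directions of the equivalence

⟦⟧∈H : ∀ x → ⟦ x ⟧ ∈ H₁,₂,₂
⟦⟧∈H (coords a b c d) = a , b , c , d , refl

-- The norms of x and of its inverse are natural numbers with product 1.
isUnit⇒‖‖≡1 : ∀ {x} → IsUnit ⟦ x ⟧ → ‖ x ‖ ≡ 1
isUnit⇒‖‖≡1 {x} (_ , w , (a , b , c , d , refl) , uw≡1 , _) =
  ℕ.m*n≡1⇒m≡1 (‖ x ‖) (‖ y ‖) (trans (sym (‖‖-· x y)) (cong ∣_∣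
    (⟦⟧-norm {x · y} {scalar 1ℤ} (trans (sym (⟦⟧-* x y)) uw≡1))))
  where y = coords a b c d

-- The conjugate is a two-sided inverse.
‖‖≡1⇒isUnit : ∀ {x} → ‖ x ‖ ≡ 1 → IsUnit ⟦ x ⟧
‖‖≡1⇒isUnit {x} ‖x‖≡1 = ⟦⟧∈H x , ⟦ conjᶜ x ⟧ , ⟦⟧∈H (conjᶜ x) ,
  trans (⟦⟧-* x (conjᶜ x)) (cong ⟦_⟧ (trans (·-conj x) norm≡1)) ,
  trans (⟦⟧-* (conjᶜ x) x) (cong ⟦_⟧ (trans (conj-· x) norm≡1))
  where
  norm≡1 : scalar (norm x) ≡ scalar 1ℤ
  norm≡1 = cong scalar (trans (norm≡+‖‖ x) (cong +_ ‖x‖≡1))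

isPrime⇒N≡p : ∀ z → IsPrime ⟦ z ⟧ → ∃[ p ] (Prime p × N ⟦ z ⟧ ≡ fromInteger (+ p))
isPrime⇒N≡p z pz =
  -- A nonzero nonunit has norm neither 0 nor 1, so some prime divides its norm.
  let p , pr , p∣‖z‖ = primeDivisor ‖ z ‖
        (λ ‖z‖≡0 → nonzero (cong ⟦_⟧ (‖x‖≡0⇒x≡0 z ‖z‖≡0)))
        (λ ‖z‖≡1 → nonunit (‖‖≡1⇒isUnit {z} ‖z‖≡1))
  in p , pr , trans (N-⟦⟧ z) (cong fromInteger (trans (norm≡+‖‖ z)
       (cong +_ (irreducible⇒‖‖≡p {p} {z} pr p∣‖z‖ irreducible))))
  where
  open IsPrime pz
  irreducible : Irreducibleᶜ z
  irreducible a b z≡ab = [ inj₁ ∘ isUnit⇒‖‖≡1 {a} , inj₂ ∘ isUnit⇒‖‖≡1 {b} ]′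
    (factor ⟦ a ⟧ ⟦ b ⟧ (⟦⟧∈H a) (⟦⟧∈H b) (trans (cong ⟦_⟧ z≡ab) (sym (⟦⟧-* a b))))

-- In a factorisation z = a b the norm of a divides p. It is 1, or it is p and leaves norm 1 for b.
‖‖≡p⇒isPrime : ∀ {p} z → Prime p → ‖ z ‖ ≡ p → IsPrime ⟦ z ⟧
‖‖≡p⇒isPrime {p} z pr ‖z‖≡p = record
  { integral = ⟦⟧∈H z
  ; nonzero  = λ z≡0 → ¬prime[0] (subst Prime (trans (sym ‖z‖≡p)
      (cong ∣_∣ (⟦⟧-norm {z} {scalar 0ℤ} z≡0))) pr)
  ; nonunit  = λ u → ¬prime[1] (subst Prime (trans (sym ‖z‖≡p) (isUnit⇒‖‖≡1 {z} u)) pr)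
  ; factor   = λ { _ _ (a₁ , a₂ , a₃ , a₄ , refl) (b₁ , b₂ , b₃ , b₄ , refl) →
      split (coords a₁ a₂ a₃ a₄) (coords b₁ b₂ b₃ b₄) }
  }
  where
  split : ∀ a b → ⟦ z ⟧ ≡ ⟦ a ⟧ * ⟦ b ⟧ → IsUnit ⟦ a ⟧ ⊎ IsUnit ⟦ b ⟧
  split a b z≡ab = [ inj₁ ∘ ‖‖≡1⇒isUnit {a} , inj₂ ∘ (λ ‖a‖≡p → ‖‖≡1⇒isUnit {b} (‖b‖≡1 ‖a‖≡p)) ]′
    (prime⇒irreducible pr (subst (‖ a ‖ ∣_) (sym p≡) (ℕ.m∣m*n (‖ b ‖))))
    where
    instance _ = prime⇒nonZero pr
    p≡ : p ≡ ‖ a ‖ ℕ.* ‖ b ‖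
    p≡ = trans (sym ‖z‖≡p) (trans (cong ∣_∣ (⟦⟧-norm {z} {a · b} (trans z≡ab (⟦⟧-* a b)))) (‖‖-· a b))
    ‖b‖≡1 : ‖ a ‖ ≡ p → ‖ b ‖ ≡ 1
    ‖b‖≡1 ‖a‖≡p = sym (ℕ.*-cancelˡ-≡ 1 (‖ b ‖) p (trans (ℕ.*-identityʳ p)
      (trans p≡ (cong (ℕ._* ‖ b ‖) ‖a‖≡p))))

theorem37 : (π : ℍ) → π ∈ H₁,₂,₂ →
    IsPrime π ⇔ (∃[ p ] (Prime p × N π ≡ fromInteger (+ p)))
theorem37 _ (a , b , c , d , refl) = mk⇔ (isPrime⇒N≡p z) λ (p , pr , Nz≡p) →
  ‖‖≡p⇒isPrime z pr (cong ∣_∣ (fromInteger-injective (trans (sym (N-⟦⟧ z)) Nz≡p)))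
  where z = coords a b c d
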